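{- Let $N=(G=(V,E),\sigma,u,s)$ be a skew-symmetric network and $f$ an IS-flow in $N$. Then $f$ has maximum value among all IS-flows in $N$ if and only if there is no r-augmenting path for $f$.
   Context: A skew-symmetric graph is a finite directed graph $G=(V,E)$ (parallel arcs allowed) with a map $\sigma$ of $V\cup E$ onto itself such that $\sigma(x)\ne x$, $\sigma(\sigma(x))=x$ for all $x$, $\sigma(V)=V$, and for each arc $a$ from $v$ to $w$, $\sigma(a)$ is an arc from $\sigma(w)$ to $\sigma(v)$; write $a'=\sigma(a)$. A function $h$ on $E$ is symmetric if $h(a)=h(\sigma(a))$. A skew-symmetric network is $N=(G,\sigma,u,s)$ with $u:E\to\mathbb Z_{\ge0}$ symmetric and source $s$; $s'=\sigma(s)$ is the sink. A flow is $f:E\to\mathbb R_{\ge0}$ with $f\le u$ and conservation ($\sum_{\text{out}}f-\sum_{\text{in}}f=0$) at every node other than $s,s'$; its value is $|f|=\sum_{\text{out of }s}f-\sum_{\text{into }s}f$. An IS-flow is an integer-valued symmetric flow. $G^+=(V,E^+)$ is obtained from $G$ by adding, for each arc $a=(x,y)\in E$, a reverse arc $a^R=(y,x)$; $\sigma$ extends by $\sigma(a^R)=(\sigma(a))^R$. The residual capacity is $u_f(a)=u(a)-f(a)$ for $a\in E$ and $u_f(a^R)=f(a)$. For a nonnegative integer symmetric function $h$ on the arcs of a skew-symmetric graph, a directed path $P$ is $h$-regular if $h(a)>0$ for every arc $a$ of $P$ and every arc $a$ of $P$ whose mate $a'$ also lies on $P$ satisfies $h(a)\ge2$. An r-augmenting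 path for $f$ is a $u_f$-regular path from $s$ to $s'$ in $G^+$. -}

module Defs where

open import Algebra.Definitions using (Involutive)
open import Data.Bool.Base using (if_then_else_)
open import Data.Fin.Base using (Fin)
open import Data.Fin.Properties using (_≟_)
open import Data.Integer.Base as ℤ using (ℤ; +_; 0ℤ)
open import Data.List.Base using (List; []; _∷_; map)
open import Data.List.Membership.Propositional using (_∈_)
open import Data.List.Relation.Unary.Unique.Propositional using (Unique)
open import Data.Nat.Base using (ℕ; _∸_; _≤_; _<_)
open import Data.Nat.Properties using (+-0-commutativeMonoid)
open import Data.Product.Base using (_×_)
open import Data.Sum.Base as Sum using (_⊎_; inj₁; inj₂; [_,_])
open import Data.Sum.Properties using (inj₁-injective; inj₂-injective)
open import Relation.Binary.PropositionalEquality using (_≡_; _≢_; cong)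
open import Relation.Nullary.Decidable.Core using (does)

open import Algebra.Properties.CommutativeMonoid.Sum +-0-commutativeMonoid
  using (sum-syntax)

-- Nodes and arcs are arbitrary types here so that the construction G⁺ below
-- stays in the same class; networks take them to be Fin n and Fin m.
-- Parallel arcs (and loops) are allowed.
record SkewSymmetricGraph (V E : Set) : Set where
  field
    tail head     : E → V
    σV            : V → V
    σE            : E → E
    σV-fixfree    : ∀ v → σV v ≢ v
    σE-fixfree    : ∀ a → σE a ≢ a
    σV-involutive : Involutive _≡_ σV
    σE-involutive : Involutive _≡_ σE
    tail-σ        : ∀ a → tail (σE a) ≡ σV (head a)
    head-σ        : ∀ a → head (σE a) ≡ σV (tail a)

module _ {V E : Set} (G : SkewSymmetricGraph V E) where
  open SkewSymmetricGraph G

  Symmetric : {A : Set} → (E → A) → Set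
  Symmetric h = ∀ a → h a ≡ h (σE a)

  -- inj₁ a is the original arc a, and inj₂ a is its reverse aᴿ.
  _⁺ : SkewSymmetricGraph V (E ⊎ E)
  _⁺ = record
    { tail          = [ tail , head ]
    ; head          = [ head , tail ]
    ; σV            = σV
    ; σE            = Sum.map σE σE
    ; σV-fixfree    = σV-fixfree
    ; σE-fixfree    = λ { (inj₁ a) eq → σE-fixfree a (inj₁-injective eq)
                        ; (inj₂ a) eq → σE-fixfree a (inj₂-injective eq) }
    ; σV-involutive = σV-involutive
    ; σE-involutive = λ { (inj₁ a) → cong inj₁ (σE-involutive a)
                        ; (inj₂ a) → cong inj₂ (σE-involutive a) }
    ; tail-σ        = [ tail-σ , head-σ ]
    ; head-σ        = [ head-σ , tail-σ ]
    }

  -- Walks are lists of arcs: with parallel arcs the nodes do not determine them.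
  IsWalk : V → List E → V → Set
  IsWalk x []      y = x ≡ y
  IsWalk x (a ∷ p) y = tail a ≡ x × IsWalk (head a) p y

  -- A path visits no node twice.
  record IsPath (x : V) (p : List E) (y : V) : Set where
    field
      walk   : IsWalk x p y
      simple : Unique (x ∷ map head p)

  record Regular (h : E → ℕ) (p : List E) : Set where
    field
      positive : ∀ a → a ∈ p → 0 < h a
      mated    : ∀ a → a ∈ p → σE a ∈ p → 2 ≤ h a

record SkewSymmetricNetwork (n m : ℕ) : Set where
  field
    G           : SkewSymmetricGraph (Fin n) (Fin m)
    u           : Fin m → ℕ
    u-symmetric : Symmetric G u
    s           : Fin n

  open SkewSymmetricGraph G public

  s′ : Fin n
  s′ = σV s

module _ {n m : ℕ} (N : SkewSymmetricNetwork n m) where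
  open SkewSymmetricNetwork N

  outflow inflow : (Fin m → ℕ) → Fin n → ℕ
  outflow f v = ∑[ a < m ] (if does (tail a ≟ v) then f a else 0)
  inflow  f v = ∑[ a < m ] (if does (head a ≟ v) then f a else 0)

  netOutflow : (Fin m → ℕ) → Fin n → ℤ
  netOutflow f v = + outflow f v ℤ.- + inflow f v

  -- An integer-valued nonnegative flow is a function into ℕ.
  record IsIntegerFlow (f : Fin m → ℕ) : Set where
    field
      capacity     : ∀ a → f a ≤ u a
      conservation : ∀ v → v ≢ s → v ≢ s′ → netOutflow f v ≡ 0ℤ

  record IsISFlow (f : Fin m → ℕ) : Set where
    field
      isIntegerFlow : IsIntegerFlow f
      symmetric     : Symmetric G f

  value : (Fin m → ℕ) → ℤ
  value f = netOutflow f s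

  IsMaximumISFlow : (Fin m → ℕ) → Set
  IsMaximumISFlow f = IsISFlow f × (∀ g → IsISFlow g → value g ℤ.≤ value f)

  -- For a flow f we have f a ≤ u a, so the truncated subtraction is exact.
  residual : (Fin m → ℕ) → Fin m ⊎ Fin m → ℕ
  residual f (inj₁ a) = u a ∸ f a
  residual f (inj₂ a) = f a

  record IsRAugmenting (f : Fin m → ℕ) (p : List (Fin m ⊎ Fin m)) : Set where
    field
      path    : IsPath (G ⁺) s p s′
      regular : Regular (G ⁺) (residual f) p

{-# OPTIONS --safe #-}
-- Pushing one unit along a walk P and one along its mate changes the divergence
-- only at the ends of P and their mates, and regularity of P with respect to the
-- residual capacities is exactly what makes this push feasible; hence an
-- r-augmenting path increases the value by 2.  Conversely, if g has larger value
-- than f, then g − f is a symmetric flow h on G⁺ of positive value below the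
-- residual capacities.  Walk greedily from s along arcs with h > 0, removing each
-- arc used together with its mate from h: the current node, unless it is s′,
-- always has positive divergence in what remains, so the walk only stops at s′.
-- It is h-regular because h remained nonnegative, and shortcutting it to a
-- simple path keeps it so.
module Submission where

open import Defs
open import Data.Bool.Base using (Bool; true; false; if_then_else_)
open import Data.Fin.Base using (Fin; zero; suc)
open import Data.Fin.Properties using (_≟_)
open import Data.Integer.Base as ℤ using (ℤ; +_; 0ℤ; +<+)
import Data.Integer.Properties as ℤ
open import Data.Integer.Tactic.RingSolver using (solve-∀)
open import Data.List.Base using (List; []; _∷_; map)
open import Data.List.Membership.Propositional using (_∈_; _∉_)
import Data.List.Membership.DecPropositional as DecMembership
open import Data.List.Relation.Binary.Subset.Propositional using (_⊆_)
open import Data.List.Relation.Binary.Subset.Propositional.Properties using (∷⁺ʳ)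
open import Data.List.Relation.Unary.All using ([])
open import Data.List.Relation.Unary.All.Properties using (¬Any⇒All¬; All¬⇒¬Any)
open import Data.List.Relation.Unary.AllPairs using ([]; _∷_)
open import Data.List.Relation.Unary.Any using (here; there)
open import Data.List.Relation.Unary.Unique.Propositional using (Unique)
open import Data.List.Relation.Unary.Unique.Propositional.Properties using (map⁻)
open import Data.Nat.Base using (ℕ; zero; suc; _+_; _∸_; _≤_; _<_; z≤n; s≤s)
open import Data.Nat.Induction using (<-wellFounded)
open import Data.Nat.Properties using (+-0-commutativeMonoid; +-commutativeSemigroup; +-comm; +-identityʳ;
  +-mono-≤; +-monoʳ-≤; +-monoˡ-≤; m+[n∸m]≡n; m∸n+n≡m; m∸n≤m; m≤m+n; m≤n+m; +-assoc;
  ∸-monoˡ-≤; ≤-refl; ≤-trans; ≤-reflexive; module ≤-Reasoning)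
open import Data.Product.Base using (∃; _×_; _,_)
open import Data.Sum.Base using (_⊎_; inj₁; inj₂; [_,_])
open import Data.Sum.Properties using (≡-dec)
open import Function.Base using (_∘_; const)
open import Function.Bundles using (_⇔_; mk⇔)
open import Induction.WellFounded using (Acc; acc)
open import Relation.Binary.Definitions using (DecidableEquality)
open import Relation.Binary.PropositionalEquality
  using (_≡_; _≢_; _≗_; refl; sym; trans; cong; cong₂; subst; module ≡-Reasoning)
open import Relation.Nullary.Decidable using (Dec; yes; no; does; does-⇔; dec-true; dec-false)
open import Relation.Nullary.Negation.Core using (¬_; contradiction)

open import Algebra.Properties.CommutativeSemigroup +-commutativeSemigroup using (interchange)
open import Algebra.Properties.CommutativeMonoid.Sum +-0-commutativeMonoid
  using (sum-syntax; sum-cong-≗; sum-replicate-zero; ∑-distrib-+)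

-- Finite sums over arcs selected by a Boolean condition.

module _ {m : ℕ} where

  -- With the endpoint tests as `c` this unfolds to `outflow` and `inflow`, so the lemmas on it
  -- apply to both without conversion.
  ∑⟨_⟩ : (Fin m → Bool) → (Fin m → ℕ) → ℕ
  ∑⟨ c ⟩ f = ∑[ a < m ] (if c a then f a else 0)

  ∑⟨⟩-cong : ∀ c {f g : Fin m → ℕ} → f ≗ g → ∑⟨ c ⟩ f ≡ ∑⟨ c ⟩ g
  ∑⟨⟩-cong c f≗g = sum-cong-≗ λ a → cong (if c a then_else 0) (f≗g a)

  ∑⟨⟩-+ : ∀ c (f g : Fin m → ℕ) → ∑⟨ c ⟩ (λ a → f a + g a) ≡ ∑⟨ c ⟩ f + ∑⟨ c ⟩ g
  ∑⟨⟩-+ c f g = trans (sum-cong-≗ λ a → if-+ (c a)) (∑-distrib-+ {m} _ _)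
    where
    if-+ : ∀ b {x y} → (if b then x + y else 0) ≡ (if b then x else 0) + (if b then y else 0)
    if-+ true  = refl
    if-+ false = refl

  ∑⟨⟩-zero : ∀ c → ∑⟨ c ⟩ (const 0) ≡ 0
  ∑⟨⟩-zero c = trans (sum-cong-≗ λ a → if-0 (c a)) (sum-replicate-zero m)
    where
    if-0 : ∀ b → (if b then 0 else 0) ≡ 0
    if-0 true  = refl
    if-0 false = refl

∑⟨⟩-indicator : ∀ {m} c (i : Fin m) →
  ∑⟨ c ⟩ (λ a → if does (i ≟ a) then 1 else 0) ≡ (if c i then 1 else 0)
∑⟨⟩-indicator c zero    =
  trans (cong (λ x → (if c zero then 1 else 0) + x) (∑⟨⟩-zero (c ∘ suc))) (+-identityʳ _)
-- The summand at `zero` is 0 in either case; the split only lets it reduce.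
∑⟨⟩-indicator c (suc i) with c zero
... | true  = ∑⟨⟩-indicator (c ∘ suc) i
... | false = ∑⟨⟩-indicator (c ∘ suc) i

∑⟨⟩-positive : ∀ {m} c (f : Fin m → ℕ) → 0 < ∑⟨ c ⟩ f → ∃ λ a → c a ≡ true × 0 < f a
∑⟨⟩-positive {suc m} c f 0<∑ with c zero in c₀ | f zero in f₀
... | true  | suc _ = zero , c₀ , subst (0 <_) (sym f₀) (s≤s z≤n)
... | true  | zero  = let a , ca , 0<fa = ∑⟨⟩-positive (c ∘ suc) (f ∘ suc) 0<∑ in suc a , ca , 0<fa
... | false | _     = let a , ca , 0<fa = ∑⟨⟩-positive (c ∘ suc) (f ∘ suc) 0<∑ in suc a , ca , 0<fa

-- Regularity and shortcutting of walks.

module _ {V E : Set} (G : SkewSymmetricGraph V E) where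
  open SkewSymmetricGraph G

  -- Regularity only concerns which arcs occur, not their order or number, so it survives
  -- shortcutting.
  Regular-⊆ : ∀ {h p q} → q ⊆ p → Regular G h p → Regular G h q
  Regular-⊆ q⊆p r = record
    { positive = λ a a∈q → positive a (q⊆p a∈q)
    ; mated    = λ a a∈q σa∈q → mated a (q⊆p a∈q) (q⊆p σa∈q) }
    where open Regular r

  Regular-mono : ∀ {h k p} → (∀ a → h a ≤ k a) → Regular G h p → Regular G k p
  Regular-mono h≤k r = record
    { positive = λ a a∈p → ≤-trans (positive a a∈p) (h≤k a)
    ; mated    = λ a a∈p σa∈p → ≤-trans (mated a a∈p σa∈p) (h≤k a) }
    where open Regular r

  Regular-[_] : ∀ a {h} → 0 < h a → Regular G h (a ∷ [])
  Regular-[ a ] 0<ha = record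
    { positive = λ { _ (here refl) → 0<ha }
    ; mated    = λ { _ (here refl) (here eq) → contradiction eq (σE-fixfree a) } }

  module _ (_≟ⱽ_ : DecidableEquality V) where
    open DecMembership _≟ⱽ_ using (_∈?_)

    suffixPath : ∀ {x z y} q → IsPath G z q y → x ∈ z ∷ map head q →
                 ∃ λ r → IsPath G x r y × r ⊆ q
    suffixPath q P (here refl) = q , P , λ a∈q → a∈q
    suffixPath (a ∷ q) record { walk = _ , w ; simple = _ ∷ u } (there x∈) =
      let r , R , r⊆q = suffixPath q (record { walk = w ; simple = u }) x∈
      in r , R , there ∘ r⊆q

    -- The rest of the walk is made simple first; if `x` occurs on the result, only the part from
    -- `x` onwards is kept. The inclusion is recorded so that regularity can be transported.
    walk⇒path : ∀ {x y} p → IsWalk G x p y → ∃ λ q → IsPath G x q y × q ⊆ p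
    walk⇒path [] x≡y = [] , record { walk = x≡y ; simple = [] ∷ [] } , λ ()
    walk⇒path {x} (a ∷ p) (tail≡x , w) with walk⇒path p w
    ... | q , Q , q⊆p with x ∈? head a ∷ map head q
    ...   | yes x∈ = let r , R , r⊆q = suffixPath q Q x∈ in r , R , there ∘ q⊆p ∘ r⊆q
    ...   | no  x∉ = a ∷ q
                   , record { walk = tail≡x , IsPath.walk Q ; simple = ¬Any⇒All¬ _ x∉ ∷ IsPath.simple Q }
                   , ∷⁺ʳ a q⊆p

  -- A repeated arc would repeat its head.
  path⇒unique : ∀ {x p y} → IsPath G x p y → Unique p
  path⇒unique P with IsPath.simple P
  ... | _ ∷ u = map⁻ u

  -- Pushing a unit along a list of arcs and along its mate.

  module _ (_≟ᴱ_ : DecidableEquality E) where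
    open DecMembership _≟ᴱ_ using (_∈?_)

    unit : E → E → ℕ
    unit a b = if does (a ≟ᴱ b) then 1 else 0

    multiplicity : List E → E → ℕ
    multiplicity []      b = 0
    multiplicity (a ∷ p) b = unit a b + multiplicity p b

    -- The second summand counts `b` on the mate of `p`. Counting occurrences, rather than testing
    -- membership, makes the push additive along a walk.
    push : List E → E → ℕ
    push p b = multiplicity p b + multiplicity p (σE b)

    push-symmetric : ∀ p → Symmetric G (push p)
    push-symmetric p b = begin
      multiplicity p b + multiplicity p (σE b)             ≡⟨ +-comm (multiplicity p b) _ ⟩
      multiplicity p (σE b) + multiplicity p b             ≡⟨ cong (λ c → multiplicity p (σE b) + multiplicity p c) (σE-involutive b) ⟨
      multiplicity p (σE b) + multiplicity p (σE (σE b))   ∎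
      where open ≡-Reasoning

    unit-σ : ∀ a b → unit a (σE b) ≡ unit (σE a) b
    unit-σ a b = cong (if_then 1 else 0) (does-⇔ (mk⇔
      (λ a≡σb → trans (cong σE a≡σb) (σE-involutive b))
      (λ σa≡b → trans (sym (σE-involutive a)) (cong σE σa≡b))) (a ≟ᴱ σE b) (σE a ≟ᴱ b))

    multiplicity-∉ : ∀ p {b} → b ∉ p → multiplicity p b ≡ 0
    multiplicity-∉ []      b∉ = refl
    multiplicity-∉ (a ∷ p) {b} b∉ rewrite dec-false (a ≟ᴱ b) (λ a≡b → b∉ (here (sym a≡b))) =
      multiplicity-∉ p (b∉ ∘ there)

    multiplicity-unique : ∀ {p} → Unique p → ∀ b → multiplicity p b ≤ 1
    multiplicity-unique []                       b = z≤n
    multiplicity-unique {a ∷ p} (a≢p ∷ u) b with a ≟ᴱ b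
    ... | yes refl = ≤-reflexive (cong suc (multiplicity-∉ p (All¬⇒¬Any a≢p)))
    ... | no  _    = multiplicity-unique u b

    -- Without repetitions each multiplicity is at most 1, so the push reaches 2 only where an arc
    -- and its mate both lie on `p`, and there regularity provides capacity 2.
    push-≤ : ∀ {h p} → Symmetric G h → Unique p → Regular G h p → ∀ b → push p b ≤ h b
    push-≤ {h} {p} sym-h u r b with b ∈? p | σE b ∈? p
    ... | yes b∈ | yes σb∈ =
      ≤-trans (+-mono-≤ (multiplicity-unique u b) (multiplicity-unique u (σE b))) (Regular.mated r b b∈ σb∈)
    ... | yes b∈ | no  σb∉ rewrite multiplicity-∉ p σb∉ | +-identityʳ (multiplicity p b) =
      ≤-trans (multiplicity-unique u b) (Regular.positive r b b∈)
    ... | no  b∉ | yes σb∈ rewrite multiplicity-∉ p b∉ | sym-h b =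
      ≤-trans (multiplicity-unique u (σE b)) (Regular.positive r (σE b) σb∈)
    ... | no  b∉ | no  σb∉ rewrite multiplicity-∉ p b∉ | multiplicity-∉ p σb∉ = z≤n

    -- Here `k` is what remains of `h` after the push along `a`. If the mate of `a` occurs later,
    -- `k` is still positive there, and the unit already removed makes `h` at least 2.
    Regular-∷ : ∀ {h k a p} → Symmetric G h → (∀ b → h b ≡ push (a ∷ []) b + k b) →
                Regular G k p → Regular G h (a ∷ p)
    Regular-∷ {h} {k} {a} {p} sym-h h≡ r = record { positive = pos ; mated = mat }
      where
      open Regular r
      unit-refl : ∀ b → unit b b ≡ 1
      unit-refl b rewrite dec-true (b ≟ᴱ b) refl = refl
      1+k≤h : suc (k a) ≤ h a
      1+k≤h rewrite h≡ a | unit-refl a = s≤s (m≤n+m (k a) _)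
      k≤h : ∀ b → k b ≤ h b
      k≤h b rewrite h≡ b = m≤n+m (k b) _
      -- The push along `a` takes a unit from the mate as well, and `h` agrees on the two arcs.
      1+kσ≤h : suc (k (σE a)) ≤ h a
      1+kσ≤h rewrite sym-h a | h≡ (σE a) | push-symmetric (a ∷ []) (σE a) | σE-involutive a
                   | unit-refl a = s≤s (m≤n+m (k (σE a)) _)
      pos : ∀ b → b ∈ a ∷ p → 0 < h b
      pos b (here refl) = ≤-trans (s≤s z≤n) 1+k≤h
      pos b (there b∈)  = ≤-trans (positive b b∈) (k≤h b)
      mat : ∀ b → b ∈ a ∷ p → σE b ∈ a ∷ p → 2 ≤ h b
      mat b (here refl) (here σa≡a)  = contradiction σa≡a (σE-fixfree b)
      mat b (here refl) (there σa∈)  = ≤-trans (s≤s (positive (σE b) σa∈)) 1+kσ≤h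
      -- Now `a` is `σE b`: the later arc `b` is the mate of the first one, and symmetry carries the
      -- bound back to `b`.
      mat b (there b∈)  (here refl)  = subst (2 ≤_) (sym (sym-h b))
        (≤-trans (s≤s (subst (λ c → 0 < k c) (sym (σE-involutive b)) (positive b b∈))) 1+kσ≤h)
      mat b (there b∈)  (there σb∈)  = ≤-trans (mated b b∈ σb∈) (k≤h b)

-- Divergences of functions on the arcs of `G ⁺`.

module _ {n m : ℕ} (N : SkewSymmetricNetwork n m) where
  open SkewSymmetricNetwork N
  open SkewSymmetricGraph (G ⁺) using () renaming
    (tail to tail⁺; head to head⁺; σE to σE⁺; tail-σ to tail⁺-σ; head-σ to head⁺-σ)

  private
    E⁺ : Set
    E⁺ = Fin m ⊎ Fin m

    _≟⁺_ : DecidableEquality E⁺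
    _≟⁺_ = ≡-dec _≟_ _≟_

    unit⁺ : E⁺ → E⁺ → ℕ
    unit⁺ = unit (G ⁺) _≟⁺_

    push⁺ : List E⁺ → E⁺ → ℕ
    push⁺ = push (G ⁺) _≟⁺_

  -- The arcs of `G ⁺` form a disjoint sum rather than a `Fin`, so original and reverse arcs are
  -- summed separately.
  ∑⁺⟨_⟩ : (E⁺ → Bool) → (E⁺ → ℕ) → ℕ
  ∑⁺⟨ c ⟩ h = ∑⟨ c ∘ inj₁ ⟩ (h ∘ inj₁) + ∑⟨ c ∘ inj₂ ⟩ (h ∘ inj₂)

  ∑⁺⟨⟩-cong : ∀ c {h k} → h ≗ k → ∑⁺⟨ c ⟩ h ≡ ∑⁺⟨ c ⟩ k
  ∑⁺⟨⟩-cong c h≗k = cong₂ _+_ (∑⟨⟩-cong _ (h≗k ∘ inj₁)) (∑⟨⟩-cong _ (h≗k ∘ inj₂))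

  ∑⁺⟨⟩-+ : ∀ c h k → ∑⁺⟨ c ⟩ (λ a → h a + k a) ≡ ∑⁺⟨ c ⟩ h + ∑⁺⟨ c ⟩ k
  ∑⁺⟨⟩-+ c h k = trans
    (cong₂ _+_ (∑⟨⟩-+ (c ∘ inj₁) (h ∘ inj₁) (k ∘ inj₁)) (∑⟨⟩-+ (c ∘ inj₂) (h ∘ inj₂) (k ∘ inj₂)))
    (interchange (∑⟨ c ∘ inj₁ ⟩ (h ∘ inj₁)) _ _ _)

  ∑⁺⟨⟩-unit : ∀ c a → ∑⁺⟨ c ⟩ (unit⁺ a) ≡ (if c a then 1 else 0)
  ∑⁺⟨⟩-unit c (inj₁ a) =
    trans (cong₂ _+_ (∑⟨⟩-indicator (c ∘ inj₁) a) (∑⟨⟩-zero (c ∘ inj₂))) (+-identityʳ _)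
  ∑⁺⟨⟩-unit c (inj₂ a) = cong₂ _+_ (∑⟨⟩-zero (c ∘ inj₁)) (∑⟨⟩-indicator (c ∘ inj₂) a)

  ∑⁺⟨⟩-positive : ∀ c h → 0 < ∑⁺⟨ c ⟩ h → ∃ λ a → c a ≡ true × 0 < h a
  ∑⁺⟨⟩-positive c h 0<∑ with ∑⟨ c ∘ inj₁ ⟩ (h ∘ inj₁) in eq
  ... | suc _ = let a , q = ∑⟨⟩-positive (c ∘ inj₁) (h ∘ inj₁) (subst (0 <_) (sym eq) (s≤s z≤n))
                in inj₁ a , q
  ... | zero  = let a , q = ∑⟨⟩-positive (c ∘ inj₂) (h ∘ inj₂) 0<∑ in inj₂ a , q

  leaves enters : Fin n → E⁺ → Bool
  leaves v a = does (tail⁺ a ≟ v)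
  enters v a = does (head⁺ a ≟ v)

  net⁺ : (E⁺ → ℕ) → Fin n → ℤ
  net⁺ h v = + ∑⁺⟨ leaves v ⟩ h ℤ.- + ∑⁺⟨ enters v ⟩ h

  δ : Fin n → Fin n → ℤ
  δ x v = + (if does (x ≟ v) then 1 else 0)

  δ-≡ : ∀ v → δ v v ≡ + 1
  δ-≡ v rewrite dec-true (v ≟ v) refl = refl

  δ-≢ : ∀ {x v} → x ≢ v → δ x v ≡ 0ℤ
  δ-≢ {x} {v} x≢v rewrite dec-false (x ≟ v) x≢v = refl

  net⁺-cong : ∀ {h k} → h ≗ k → ∀ v → net⁺ h v ≡ net⁺ k v
  net⁺-cong h≗k v = cong₂ (λ o i → + o ℤ.- + i) (∑⁺⟨⟩-cong (leaves v) h≗k) (∑⁺⟨⟩-cong (enters v) h≗k)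

  net⁺-+ : ∀ h k v → net⁺ (λ a → h a + k a) v ≡ net⁺ h v ℤ.+ net⁺ k v
  net⁺-+ h k v = trans
    (cong₂ (λ o i → + o ℤ.- + i) (∑⁺⟨⟩-+ (leaves v) h k) (∑⁺⟨⟩-+ (enters v) h k))
    (trans (cong₂ ℤ._-_ (ℤ.pos-+ (∑⁺⟨ leaves v ⟩ h) _) (ℤ.pos-+ (∑⁺⟨ enters v ⟩ h) _))
           (ring (+ ∑⁺⟨ leaves v ⟩ h) (+ ∑⁺⟨ leaves v ⟩ k) (+ ∑⁺⟨ enters v ⟩ h) (+ ∑⁺⟨ enters v ⟩ k)))
    where
    ring : ∀ a b c d → (a ℤ.+ b) ℤ.- (c ℤ.+ d) ≡ (a ℤ.- c) ℤ.+ (b ℤ.- d)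
    ring = solve-∀

  net⁺-unit : ∀ a v → net⁺ (unit⁺ a) v ≡ δ (tail⁺ a) v ℤ.- δ (head⁺ a) v
  net⁺-unit a v = cong₂ (λ o i → + o ℤ.- + i) (∑⁺⟨⟩-unit (leaves v) a) (∑⁺⟨⟩-unit (enters v) a)

  -- A telescoping sum: the mates form a walk from `σV y` to `σV x`, and along both walks the
  -- contributions at intermediate nodes cancel.
  net⁺-push : ∀ {x y} p → IsWalk (G ⁺) x p y → ∀ v →
    net⁺ (push⁺ p) v ≡ (δ x v ℤ.- δ y v) ℤ.+ (δ (σV y) v ℤ.- δ (σV x) v)
  net⁺-push {x} [] refl v = trans
    (cong₂ (λ o i → + o ℤ.- + i) (∑⁺-zero (leaves v)) (∑⁺-zero (enters v))) (ring (δ x v) (δ (σV x) v))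
    where
    ∑⁺-zero : ∀ c → ∑⁺⟨ c ⟩ (push⁺ []) ≡ 0
    ∑⁺-zero c = cong₂ _+_ (∑⟨⟩-zero (c ∘ inj₁)) (∑⟨⟩-zero (c ∘ inj₂))
    ring : ∀ a b → 0ℤ ≡ (a ℤ.- a) ℤ.+ (b ℤ.- b)
    ring = solve-∀
  net⁺-push {y = y} (a ∷ p) (refl , w) v = begin
    net⁺ (push⁺ (a ∷ p)) v
      ≡⟨ net⁺-cong split v ⟩
    net⁺ (λ b → (unit⁺ a b + unit⁺ (σE⁺ a) b) + push⁺ p b) v
      ≡⟨ net⁺-+ (λ b → unit⁺ a b + unit⁺ (σE⁺ a) b) (push⁺ p) v ⟩
    net⁺ (λ b → unit⁺ a b + unit⁺ (σE⁺ a) b) v ℤ.+ net⁺ (push⁺ p) v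
      ≡⟨ cong₂ ℤ._+_ (net⁺-+ (unit⁺ a) (unit⁺ (σE⁺ a)) v) (net⁺-push p w v) ⟩
    (net⁺ (unit⁺ a) v ℤ.+ net⁺ (unit⁺ (σE⁺ a)) v)
      ℤ.+ ((δ (head⁺ a) v ℤ.- δ y v) ℤ.+ (δ (σV y) v ℤ.- δ (σV (head⁺ a)) v))
      ≡⟨ cong₂ (λ x y′ → (x ℤ.+ y′) ℤ.+ ((δ (head⁺ a) v ℤ.- δ y v) ℤ.+ (δ (σV y) v ℤ.- δ (σV (head⁺ a)) v)))
           (net⁺-unit a v) (net⁺-unit (σE⁺ a) v) ⟩
    ((δ (tail⁺ a) v ℤ.- δ (head⁺ a) v) ℤ.+ (δ (tail⁺ (σE⁺ a)) v ℤ.- δ (head⁺ (σE⁺ a)) v))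
      ℤ.+ ((δ (head⁺ a) v ℤ.- δ y v) ℤ.+ (δ (σV y) v ℤ.- δ (σV (head⁺ a)) v))
      ≡⟨ cong₂ (λ t h → ((δ (tail⁺ a) v ℤ.- δ (head⁺ a) v) ℤ.+ (δ t v ℤ.- δ h v))
           ℤ.+ ((δ (head⁺ a) v ℤ.- δ y v) ℤ.+ (δ (σV y) v ℤ.- δ (σV (head⁺ a)) v)))
           (tail⁺-σ a) (head⁺-σ a) ⟩
    ((δ (tail⁺ a) v ℤ.- δ (head⁺ a) v) ℤ.+ (δ (σV (head⁺ a)) v ℤ.- δ (σV (tail⁺ a)) v))
      ℤ.+ ((δ (head⁺ a) v ℤ.- δ y v) ℤ.+ (δ (σV y) v ℤ.- δ (σV (head⁺ a)) v))
      ≡⟨ ring (δ (tail⁺ a) v) (δ (head⁺ a) v) (δ (σV (head⁺ a)) v) (δ (σV (tail⁺ a)) v) (δ y v) (δ (σV y) v) ⟩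
    (δ (tail⁺ a) v ℤ.- δ y v) ℤ.+ (δ (σV y) v ℤ.- δ (σV (tail⁺ a)) v) ∎
    where
    open ≡-Reasoning
    split : ∀ b → push⁺ (a ∷ p) b ≡ (unit⁺ a b + unit⁺ (σE⁺ a) b) + push⁺ p b
    split b = trans (interchange (unit⁺ a b) _ _ _)
                    (cong (λ x → (unit⁺ a b + x) + push⁺ p b) (unit-σ (G ⁺) _≟⁺_ a b))
    ring : ∀ t h h′ t′ y y′ → ((t ℤ.- h) ℤ.+ (h′ ℤ.- t′)) ℤ.+ ((h ℤ.- y) ℤ.+ (y′ ℤ.- h′))
                            ≡ (t ℤ.- y) ℤ.+ (y′ ℤ.- t′)
    ring = solve-∀

  -- A unit on a reverse arc leaving `v` cancels a unit entering `v`. The additive hypothesis avoids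
  -- truncated subtraction and serves both directions of the theorem: `h` may be a push or the
  -- difference of two flows.
  netOutflow-augment : ∀ {f g} h → (∀ a → g a + h (inj₂ a) ≡ f a + h (inj₁ a)) → ∀ v →
    netOutflow N g v ≡ netOutflow N f v ℤ.+ net⁺ h v
  netOutflow-augment {f} {g} h g+h₂≡f+h₁ v = begin
    + outflow N g v ℤ.- + inflow N g v
      -- The reverse sums are added and subtracted so that the hypothesis applies to whole sums.
      ≡⟨ ring₁ (+ outflow N g v) (+ o₂) (+ inflow N g v) (+ i₂) ⟩
    ((+ outflow N g v ℤ.+ + o₂) ℤ.- (+ inflow N g v ℤ.+ + i₂)) ℤ.+ (+ i₂ ℤ.- + o₂)
      ≡⟨ cong₂ (λ o i → (o ℤ.- i) ℤ.+ (+ i₂ ℤ.- + o₂)) (shift λ a → does (tail a ≟ v)) (shift λ a → does (head a ≟ v)) ⟩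
    ((+ outflow N f v ℤ.+ + o₁) ℤ.- (+ inflow N f v ℤ.+ + i₁)) ℤ.+ (+ i₂ ℤ.- + o₂)
      ≡⟨ ring₂ (+ outflow N f v) (+ inflow N f v) (+ o₁) (+ o₂) (+ i₁) (+ i₂) ⟩
    netOutflow N f v ℤ.+ ((+ o₁ ℤ.+ + i₂) ℤ.- (+ i₁ ℤ.+ + o₂))
      ≡⟨ cong (λ x → netOutflow N f v ℤ.+ x) (cong₂ ℤ._-_ (ℤ.pos-+ o₁ i₂) (ℤ.pos-+ i₁ o₂)) ⟨
    netOutflow N f v ℤ.+ net⁺ h v ∎
    where
    open ≡-Reasoning
    o₁ = outflow N (h ∘ inj₁) v
    o₂ = outflow N (h ∘ inj₂) v
    i₁ = inflow N (h ∘ inj₁) v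
    i₂ = inflow N (h ∘ inj₂) v
    shift : ∀ c → + ∑⟨ c ⟩ g ℤ.+ + ∑⟨ c ⟩ (h ∘ inj₂) ≡ + ∑⟨ c ⟩ f ℤ.+ + ∑⟨ c ⟩ (h ∘ inj₁)
    shift c = begin
      + ∑⟨ c ⟩ g ℤ.+ + ∑⟨ c ⟩ (h ∘ inj₂)    ≡⟨ ℤ.pos-+ (∑⟨ c ⟩ g) _ ⟨
      + (∑⟨ c ⟩ g + ∑⟨ c ⟩ (h ∘ inj₂))      ≡⟨ cong +_ (∑⟨⟩-+ c g (h ∘ inj₂)) ⟨
      + ∑⟨ c ⟩ (λ a → g a + h (inj₂ a))     ≡⟨ cong +_ (∑⟨⟩-cong c g+h₂≡f+h₁) ⟩
      + ∑⟨ c ⟩ (λ a → f a + h (inj₁ a))     ≡⟨ cong +_ (∑⟨⟩-+ c f (h ∘ inj₁)) ⟩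
      + (∑⟨ c ⟩ f + ∑⟨ c ⟩ (h ∘ inj₁))      ≡⟨ ℤ.pos-+ (∑⟨ c ⟩ f) _ ⟩
      + ∑⟨ c ⟩ f ℤ.+ + ∑⟨ c ⟩ (h ∘ inj₁)    ∎
    ring₁ : ∀ a b c d → a ℤ.- c ≡ ((a ℤ.+ b) ℤ.- (c ℤ.+ d)) ℤ.+ (d ℤ.- b)
    ring₁ = solve-∀
    ring₂ : ∀ of if o₁ o₂ i₁ i₂ → ((of ℤ.+ o₁) ℤ.- (if ℤ.+ i₁)) ℤ.+ (i₂ ℤ.- o₂)
                                ≡ (of ℤ.- if) ℤ.+ ((o₁ ℤ.+ i₂) ℤ.- (i₁ ℤ.+ o₂))
    ring₂ = solve-∀

  -- Extraction of a regular walk.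

  -- Invariant of the greedy walk: by net⁺-push, removing from h a walk from s to v
  -- and its mate changes net⁺ h by exactly what keeps this quantity constant.
  potential : (E⁺ → ℕ) → Fin n → Fin n → ℤ
  potential h v w = net⁺ h w ℤ.- (δ v w ℤ.- δ (σV v) w)

  potential-step : ∀ {h k} a → (∀ b → h b ≡ push⁺ (a ∷ []) b + k b) → ∀ w →
    potential h (tail⁺ a) w ≡ potential k (head⁺ a) w
  potential-step {h} {k} a h≡ w = begin
    net⁺ h w ℤ.- (δ (tail⁺ a) w ℤ.- δ (σV (tail⁺ a)) w)
      ≡⟨ cong (ℤ._- _) (trans (net⁺-cong h≡ w) (net⁺-+ (push⁺ (a ∷ [])) k w)) ⟩
    (net⁺ (push⁺ (a ∷ [])) w ℤ.+ net⁺ k w) ℤ.- (δ (tail⁺ a) w ℤ.- δ (σV (tail⁺ a)) w)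
      ≡⟨ cong (λ x → (x ℤ.+ net⁺ k w) ℤ.- (δ (tail⁺ a) w ℤ.- δ (σV (tail⁺ a)) w))
           (net⁺-push (a ∷ []) (refl , refl) w) ⟩
    (((δ (tail⁺ a) w ℤ.- δ (head⁺ a) w) ℤ.+ (δ (σV (head⁺ a)) w ℤ.- δ (σV (tail⁺ a)) w)) ℤ.+ net⁺ k w)
      ℤ.- (δ (tail⁺ a) w ℤ.- δ (σV (tail⁺ a)) w)
      ≡⟨ ring (δ (tail⁺ a) w) (δ (head⁺ a) w) (δ (σV (head⁺ a)) w) (δ (σV (tail⁺ a)) w) (net⁺ k w) ⟩
    net⁺ k w ℤ.- (δ (head⁺ a) w ℤ.- δ (σV (head⁺ a)) w) ∎
    where
    open ≡-Reasoning
    ring : ∀ t h h′ t′ e → (((t ℤ.- h) ℤ.+ (h′ ℤ.- t′)) ℤ.+ e) ℤ.- (t ℤ.- t′) ≡ e ℤ.- (h ℤ.- h′)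
    ring = solve-∀

  -- At `v` itself the correction term is 1, because `σV v` differs from `v`; so outflow exceeds
  -- inflow and some leaving arc is positive.
  potential⇒arc : ∀ h v → 0ℤ ℤ.≤ potential h v v → ∃ λ a → tail⁺ a ≡ v × 0 < h a
  potential⇒arc h v 0≤ =
    let a , does≡ , 0<ha = ∑⁺⟨⟩-positive (leaves v) h (≤-trans (s≤s z≤n) 1+in≤out)
    in a , from-does (tail⁺ a ≟ v) does≡ , 0<ha
    where
    out = ∑⁺⟨ leaves v ⟩ h
    in⁺ = ∑⁺⟨ enters v ⟩ h
    ring : ∀ o i → (o ℤ.- i) ℤ.- (+ 1 ℤ.- + 0) ≡ o ℤ.- (+ 1 ℤ.+ i)
    ring = solve-∀
    1+in≤out : suc in⁺ ≤ out
    1+in≤out = ℤ.drop‿+≤+ (ℤ.0≤i-j⇒j≤i (subst (0ℤ ℤ.≤_)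
      (trans (cong₂ (λ x y → net⁺ h v ℤ.- (x ℤ.- y)) (δ-≡ v) (δ-≢ (σV-fixfree v))) (ring (+ out) (+ in⁺))) 0≤))
    from-does : ∀ {A : Set} (d : Dec A) → does d ≡ true → A
    from-does (yes a) _ = a

  -- The recursion is on the total of `h`. Nonnegativity is assumed at all nodes but `s′`, since any
  -- of them may come next, while at `s′` the walk stops.
  regularWalk : ∀ h → Symmetric (G ⁺) h → Acc _<_ (∑⁺⟨ const true ⟩ h) →
    ∀ v → (∀ w → w ≢ s′ → 0ℤ ℤ.≤ potential h v w) →
    ∃ λ p → IsWalk (G ⁺) v p s′ × Regular (G ⁺) h p
  regularWalk h sym-h (acc rec) v 0≤pot with v ≟ s′
  ... | yes v≡s′ = [] , v≡s′ , record { positive = λ _ () ; mated = λ _ () }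
  ... | no  v≢s′ with potential⇒arc h v (0≤pot v v≢s′)
  ...   | a , refl , 0<ha =
    let p , w , r = regularWalk k sym-k (rec k<h) (head⁺ a)
                      λ w w≢s′ → subst (0ℤ ℤ.≤_) (potential-step a h≡ w) (0≤pot w w≢s′)
    in a ∷ p , (refl , w) , Regular-∷ (G ⁺) _≟⁺_ sym-h h≡ r
    where
    pushₐ k : E⁺ → ℕ
    pushₐ = push⁺ (a ∷ [])
    k b = h b ∸ pushₐ b
    h≡ : ∀ b → h b ≡ pushₐ b + k b
    -- The subtraction is exact: a single positive arc is regular, so its push fits below `h`.
    h≡ b = sym (m+[n∸m]≡n (push-≤ (G ⁺) _≟⁺_ sym-h ([] ∷ []) (Regular-[_] (G ⁺) a 0<ha) b))
    sym-k : Symmetric (G ⁺) k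
    sym-k b = cong₂ _∸_ (sym-h b) (push-symmetric (G ⁺) _≟⁺_ (a ∷ []) b)
    -- The unit on `a` alone gives the strict decrease; the share of its mate, `rest`, is simply
    -- dropped.
    k<h : ∑⁺⟨ const true ⟩ k < ∑⁺⟨ const true ⟩ h
    k<h = begin-strict
      total k                                   <⟨ ≤-refl ⟩
      1 + total k                               ≡⟨ cong (_+ total k) (∑⁺⟨⟩-unit (const true) a) ⟨
      total (unit⁺ a) + total k                 ≤⟨ +-monoˡ-≤ (total k) (m≤m+n (total (unit⁺ a)) (total rest)) ⟩
      (total (unit⁺ a) + total rest) + total k  ≡⟨ cong (_+ total k) (∑⁺⟨⟩-+ (const true) (unit⁺ a) rest) ⟨
      total (λ b → unit⁺ a b + rest b) + total k
        -- The count in a one-arc list ends in `+ 0`, which `+-assoc` absorbs.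
        ≡⟨ cong (_+ total k) (∑⁺⟨⟩-cong (const true) λ b → +-assoc (unit⁺ a b) 0 (rest b)) ⟨
      total pushₐ + total k                     ≡⟨ ∑⁺⟨⟩-+ (const true) pushₐ k ⟨
      total (λ b → pushₐ b + k b)               ≡⟨ ∑⁺⟨⟩-cong (const true) h≡ ⟨
      total h                                   ∎
      where
      open ≤-Reasoning
      total : (E⁺ → ℕ) → ℕ
      total = ∑⁺⟨ const true ⟩
      rest : E⁺ → ℕ
      rest b = multiplicity (G ⁺) _≟⁺_ (a ∷ []) (σE⁺ b)

  -- Augmentation and its converse.

  residual-symmetric : ∀ {f} → IsISFlow N f → Symmetric (G ⁺) (residual N f)
  residual-symmetric F (inj₁ a) = cong₂ _∸_ (u-symmetric a) (IsISFlow.symmetric F a)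
  residual-symmetric F (inj₂ a) = IsISFlow.symmetric F a

  augment : ∀ {f} → IsISFlow N f → ∀ p → IsRAugmenting N f p →
            ∃ λ g → IsISFlow N g × value N f ℤ.< value N g
  augment {f} F p A = g , isISFlow , increase
    where
    open IsISFlow F
    open IsIntegerFlow isIntegerFlow
    open IsRAugmenting A
    h : E⁺ → ℕ
    h = push⁺ p
    g : Fin m → ℕ
    g a = (f a + h (inj₁ a)) ∸ h (inj₂ a)
    h≤residual : ∀ b → h b ≤ residual N f b
    h≤residual = push-≤ (G ⁺) _≟⁺_ (residual-symmetric F) (path⇒unique (G ⁺) path) regular
    g+h₂≡f+h₁ : ∀ a → g a + h (inj₂ a) ≡ f a + h (inj₁ a)
    g+h₂≡f+h₁ a = m∸n+n≡m (≤-trans (h≤residual (inj₂ a)) (m≤m+n (f a) _))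
    net-g : ∀ v → netOutflow N g v ≡ netOutflow N f v ℤ.+ ((δ s v ℤ.- δ s′ v) ℤ.+ (δ s v ℤ.- δ s′ v))
    net-g v = trans (netOutflow-augment h g+h₂≡f+h₁ v) (cong (λ x → netOutflow N f v ℤ.+ x)
      (trans (net⁺-push p (IsPath.walk path) v)
             -- Since `σV s′` is `s`, the mate walk also leads from `s` to `s′`, which doubles the
             -- gain.
             (cong (λ x → (δ s v ℤ.- δ s′ v) ℤ.+ (δ x v ℤ.- δ s′ v)) (σV-involutive s))))
    isISFlow : IsISFlow N g
    isISFlow = record
      { isIntegerFlow = record
        { capacity     = λ a → ≤-trans (m∸n≤m _ (h (inj₂ a)))
            (≤-trans (+-monoʳ-≤ (f a) (h≤residual (inj₁ a))) (≤-reflexive (m+[n∸m]≡n (capacity a))))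
        ; conservation = λ v v≢s v≢s′ → trans (net-g v)
            (cong₂ (λ x y → x ℤ.+ (y ℤ.+ y)) (conservation v v≢s v≢s′)
              (cong₂ ℤ._-_ (δ-≢ (v≢s ∘ sym)) (δ-≢ (v≢s′ ∘ sym))))
        }
      ; symmetric     = λ a → cong₂ _∸_
          (cong₂ _+_ (symmetric a) (push-symmetric (G ⁺) _≟⁺_ p (inj₁ a)))
          (push-symmetric (G ⁺) _≟⁺_ p (inj₂ a))
      }
    increase : value N f ℤ.< value N g
    increase = begin-strict
      value N f             ≡⟨ ℤ.+-identityʳ _ ⟨
      value N f ℤ.+ 0ℤ      <⟨ ℤ.+-monoʳ-< (value N f) (+<+ (s≤s z≤n)) ⟩
      value N f ℤ.+ + 2     ≡⟨ cong (λ y → value N f ℤ.+ (y ℤ.+ y)) (cong₂ ℤ._-_ (δ-≡ s) (δ-≢ (σV-fixfree s))) ⟨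
      value N f ℤ.+ ((δ s s ℤ.- δ s′ s) ℤ.+ (δ s s ℤ.- δ s′ s)) ≡⟨ net-g s ⟨
      value N g             ∎
      where open ℤ.≤-Reasoning

  r-augmenting : ∀ {f g} → IsISFlow N f → IsISFlow N g → value N f ℤ.< value N g →
                 ∃ (IsRAugmenting N f)
  r-augmenting {f} {g} F K f<g =
    let p , w , r   = regularWalk h sym-h (<-wellFounded _) s 0≤pot
        q , Q , q⊆p = walk⇒path (G ⁺) _≟_ p w
    in q , record { path = Q ; regular = Regular-⊆ (G ⁺) q⊆p (Regular-mono (G ⁺) h≤residual r) }
    where
    module F = IsISFlow F
    module K = IsISFlow K
    h : E⁺ → ℕ
    -- The positive part of the difference `g` minus `f` goes on the original arcs, the negative
    -- part on the reverse arcs.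
    h = [ (λ a → g a ∸ f a) , (λ a → f a ∸ g a) ]
    sym-h : Symmetric (G ⁺) h
    sym-h (inj₁ a) = cong₂ _∸_ (K.symmetric a) (F.symmetric a)
    sym-h (inj₂ a) = cong₂ _∸_ (F.symmetric a) (K.symmetric a)
    h≤residual : ∀ b → h b ≤ residual N f b
    h≤residual (inj₁ a) = ∸-monoˡ-≤ (f a) (IsIntegerFlow.capacity K.isIntegerFlow a)
    h≤residual (inj₂ a) = m∸n≤m (f a) (g a)
    net-h : ∀ v → net⁺ h v ≡ netOutflow N g v ℤ.- netOutflow N f v
    net-h v = trans (ring (netOutflow N f v) (net⁺ h v))
      (cong (ℤ._- netOutflow N f v) (sym (netOutflow-augment {f} {g} h (λ a → max-comm (g a) (f a)) v)))
      where
      ring : ∀ x y → y ≡ (x ℤ.+ y) ℤ.- x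
      ring = solve-∀
      -- Both sides are the maximum of `i` and `j`.
      max-comm : ∀ i j → i + (j ∸ i) ≡ j + (i ∸ j)
      max-comm zero    zero    = refl
      max-comm zero    (suc j) = sym (+-identityʳ _)
      max-comm (suc i) zero    = +-identityʳ _
      max-comm (suc i) (suc j) = cong suc (max-comm i j)
    0≤pot : ∀ w → w ≢ s′ → 0ℤ ℤ.≤ potential h s w
    0≤pot w w≢s′ with w ≟ s
    -- Values are integers, so the strict inequality leaves a gap of at least 1, which pays for the
    -- correction term at `s`.
    ... | yes refl = subst (0ℤ ℤ.≤_)
      (trans (ring (value N g) (value N f))
             (sym (cong₂ ℤ._-_ (net-h w) (cong₂ ℤ._-_ (δ-≡ w) (δ-≢ (w≢s′ ∘ sym))))))
      (ℤ.i≤j⇒0≤j-i (ℤ.i<j⇒suc[i]≤j f<g))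
      where
      ring : ∀ x y → x ℤ.- (+ 1 ℤ.+ y) ≡ (x ℤ.- y) ℤ.- (+ 1 ℤ.- + 0)
      ring = solve-∀
    -- Both flows are conserved at `w`, so the potential vanishes.
    ... | no w≢s = ℤ.≤-reflexive (sym (trans
      (cong₂ ℤ._-_ (net-h w) (cong₂ ℤ._-_ (δ-≢ (w≢s ∘ sym)) (δ-≢ (w≢s′ ∘ sym))))
      (cong₂ (λ x y → (x ℤ.- y) ℤ.- (+ 0 ℤ.- + 0))
        (IsIntegerFlow.conservation K.isIntegerFlow w w≢s w≢s′)
        (IsIntegerFlow.conservation F.isIntegerFlow w w≢s w≢s′))))

mainTheorem4 : ∀ {n m : ℕ} (N : SkewSymmetricNetwork n m) (f : Fin m → ℕ) →
    IsISFlow N f →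
    IsMaximumISFlow N f ⇔ (¬ ∃ (IsRAugmenting N f))
mainTheorem4 N f F = mk⇔
  (λ (_ , maximal) (p , A) →
    let g , K , f<g = augment N F p A in ℤ.<⇒≱ f<g (maximal g K))
  (λ none → F , λ g K → ℤ.≮⇒≥ (none ∘ r-augmenting N F K))
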